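{- Given two integers $r$ and $k$, there exists a graph $H_{r,k}$ of treelength $2$ such that \[ \mathrm{pc}_r(H_{r,k},k)\in\Omega(r^22^k). \]
   Context: All graphs are simple, loopless and undirected. $\mathrm{dist}_G(u,v)$ is the usual graph distance (number of edges of a shortest path, $+\infty$ if there is none). For an integer $r$, let $\mathrm{Cap}_r(\ell)=\ell$ if $\ell\le r$ and $\mathrm{Cap}_r(\ell)=+\infty$ otherwise. For $A\subseteq V(G)$ and $v\in V(G)$, the $r$-profile of $v$ with respect to $A$ is the function $p_r(v,A):A\to\mathbb N\cup\{+\infty\}$, $a\mapsto \mathrm{Cap}_r(\mathrm{dist}_G(a,v))$. Let $\mathrm{pc}_r(G,A)=\big|\{p_r(v,A): v\in V(G)\}\setminus\{a\mapsto+\infty\}\big|$ (the number of distinct $r$-profiles with respect to $A$, not counting the constant $+\infty$ profile), and let $\mathrm{pc}_r(G,k)=\max\{\mathrm{pc}_r(G,A): A\subseteq V(G), |A|=k\}$ (the $r$-profile complexity of $G$). A tree representation of $G$ is a pair $(T,\{T_v\}_{v\in V(G)})$ where $T$ is a tree, each $T_v$ is a subtree of $T$, and $T_u,T_v$ share a node of $T$ whenever $uv\in E(G)$. The bag at a node $t$ of $T$ is $\beta(t)=\{v\in V(G): t\in V(T_v)\}$. The length of the representation is $\max_{t\in V(T)}\max_{u,v\in\beta(t)}\mathrm{dist}_G(u,v)$, and the treelength of $G$ is the minimum length of a tree representation of $G$. -}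

module Defs where

open import Level using (0ℓ; Level)
open import Data.Bool.Base using (if_then_else_)
open import Data.Nat.Base using (ℕ; zero; suc; _+_; _*_; _∸_; _^_; _≤_; _<_; z≤n; s≤s)
open import Data.Nat.Properties as ℕ using (_≤?_)
open import Data.Nat.Induction using (<-rec)
open import Data.Fin.Base as Fin using (Fin; zero; suc; toℕ; inject₁; fromℕ)
open import Data.Fin.Properties as Fin using (any?; all?; pigeonhole)
open import Data.Fin.Subset using (Subset; inside; outside; _∈_; Nonempty; ∣_∣)
open import Data.Fin.Subset.Properties using (_∈?_)
open import Data.Vec.Base using ([]; _∷_)
open import Data.List.Base
  using (List; []; _∷_; _++_; map; filter; deduplicate; length; allFin;
         concatMap; cartesianProductWith)
open import Data.List.Membership.Propositional renaming (_∈_ to _∈ᴸ_)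
open import Data.List.Membership.Propositional.Properties using (∈-map⁺; ∈-++⁺ˡ; ∈-++⁺ʳ)
open import Data.List.Relation.Unary.Any using (here)
open import Data.Product.Base using (Σ; ∃; ∃-syntax; _×_; _,_; proj₁; proj₂)
open import Data.Sum.Base using (_⊎_; inj₁; inj₂)
open import Function.Base using (_∘_)
open import Function.Definitions using (Injective)
open import Relation.Nullary using (¬_; Dec; yes; no; does; contradiction; ¬?; _×-dec_; _→-dec_)
open import Relation.Nullary.Decidable using (map′)
open import Relation.Nullary.Construct.Add.Supremum using (_⁺; [_]; ⊤⁺; ≡-dec)
import Relation.Binary.Construct.Add.Supremum.NonStrict as AddSup
open import Relation.Binary.Bundles using (TotalOrder)
open import Relation.Binary.Core using (Rel)
open import Relation.Binary.Definitions using (Decidable; Symmetric)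
open import Relation.Binary.Construct.Closure.ReflexiveTransitive using (Star)
open import Relation.Binary.PropositionalEquality using (_≡_; refl; sym; subst)
import Relation.Unary as Unary
import Data.List.Extrema as Extrema

-- ℕ ∪ {+∞}

ℕ∞ : Set
ℕ∞ = ℕ ⁺

pattern ∞ = ⊤⁺

_≟∞_ : Decidable {A = ℕ∞} _≡_
_≟∞_ = ≡-dec ℕ._≟_

open AddSup _≤_ public using (_≤⊤⁺) renaming (_≤⁺_ to _≤∞_; [_] to [_]≤)

≤∞-totalOrder : TotalOrder 0ℓ 0ℓ 0ℓ
≤∞-totalOrder = record
  { isTotalOrder = AddSup.≤⁺-isTotalOrder-≡ _≤_ ℕ.≤-isTotalOrder }

Cap : ℕ → ℕ∞ → ℕ∞
Cap r [ ℓ ] = if does (ℓ ≤? r) then [ ℓ ] else ∞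
Cap r ∞     = ∞

-- Finite simple graphs on the vertex set Fin order

record Graph : Set₁ where
  infix 4 _~_ _~?_
  field
    order    : ℕ
    _~_      : Rel (Fin order) 0ℓ
    _~?_     : Decidable _~_
    ~-sym    : Symmetric _~_
    ~-irrefl : ∀ {v} → ¬ (v ~ v)

  V : Set
  V = Fin order

  infixr 5 _◅_

  data Walk : V → V → ℕ → Set where
    ε   : ∀ {u} → Walk u u 0
    _◅_ : ∀ {u w v ℓ} → u ~ w → Walk w v ℓ → Walk u v (suc ℓ)

  IsDist : V → V → ℕ∞ → Set
  IsDist u v [ d ] = Walk u v d × (∀ {ℓ} → Walk u v ℓ → d ≤ ℓ)
  IsDist u v ∞     = ∀ {ℓ} → ¬ Walk u v ℓ

  -- Existence of distances: a walk with at least `order` edges repeats a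
  -- vertex, so only finitely many lengths need to be searched.

  private
    walk? : ∀ ℓ u v → Dec (Walk u v ℓ)
    walk? zero    u v = map′ (λ { refl → ε }) (λ { ε → refl }) (u Fin.≟ v)
    walk? (suc ℓ) u v = map′ (λ { (w , e , p) → e ◅ p }) (λ { (e ◅ p) → _ , e , p })
                             (any? (λ w → u ~? w ×-dec walk? ℓ w v))

    at : ∀ {u v ℓ} → Walk u v ℓ → Fin (suc ℓ) → V
    at {u} p       zero    = u
    at     (e ◅ p) (suc i) = at p i

    takeW : ∀ {u v ℓ} (p : Walk u v ℓ) i → Walk u (at p i) (toℕ i)
    takeW p       zero    = ε
    takeW (e ◅ p) (suc i) = e ◅ takeW p i

    dropW : ∀ {u v ℓ} (p : Walk u v ℓ) i → Walk (at p i) v (ℓ ∸ toℕ i)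
    dropW p       zero    = p
    dropW (e ◅ p) (suc i) = dropW p i

    _◅◅_ : ∀ {u w v k ℓ} → Walk u w k → Walk w v ℓ → Walk u v (k + ℓ)
    ε       ◅◅ q = q
    (e ◅ p) ◅◅ q = e ◅ (p ◅◅ q)

    shorten : ∀ {u v ℓ} → order ≤ ℓ → Walk u v ℓ → ∃[ m ] m < ℓ × Walk u v m
    shorten {u} {v} {ℓ} n≤ℓ p with pigeonhole (s≤s n≤ℓ) (at p)
    ... | i , j , i<j , eq =
      _ , ℕ.<-≤-trans (ℕ.+-monoˡ-< (ℓ ∸ toℕ j) i<j)
                      (ℕ.≤-reflexive (ℕ.m+[n∸m]≡n (ℕ.≤-pred (Fin.toℕ<n j))))
        , takeW p i ◅◅ subst (λ w → Walk w v (ℓ ∸ toℕ j)) (sym eq) (dropW p j)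

    short : ∀ {u v} ℓ → Walk u v ℓ → ∃[ m ] m < order × Walk u v m
    short {u} {v} = <-rec (λ ℓ → Walk u v ℓ → ∃[ m ] m < order × Walk u v m) step
      where
      step : ∀ ℓ → (∀ {m} → m < ℓ → Walk u v m → ∃[ k ] k < order × Walk u v k) →
             Walk u v ℓ → ∃[ k ] k < order × Walk u v k
      step ℓ rec p with order ≤? ℓ
      ... | no  n≰ℓ = ℓ , ℕ.≰⇒> n≰ℓ , p
      ... | yes n≤ℓ with shorten n≤ℓ p
      ...   | m , m<ℓ , q = rec m<ℓ q

    least : ∀ u v n → (∃[ d ] IsDist u v [ d ]) ⊎ (∀ {m} → m < n → ¬ Walk u v m)
    least u v zero = inj₂ λ ()
    least u v (suc n) with least u v n
    ... | inj₁ found = inj₁ found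
    ... | inj₂ none with walk? n u v
    ...   | yes p = inj₁ (n , p , λ q → ℕ.≮⇒≥ (λ m<n → none m<n q))
    ...   | no ¬p = inj₂ λ m<1+n q → case-≤ (ℕ.m≤n⇒m<n∨m≡n (ℕ.≤-pred m<1+n)) q
      where
      case-≤ : ∀ {m} → m < n ⊎ m ≡ n → ¬ Walk u v m
      case-≤ (inj₁ m<n)  = none m<n
      case-≤ (inj₂ refl) = ¬p

    ∃dist : ∀ u v → ∃ (IsDist u v)
    ∃dist u v with least u v order
    ... | inj₁ (d , isDist) = [ d ] , isDist
    ... | inj₂ none = ∞ , λ p → let (_ , m<n , q) = short _ p in none m<n q

  dist : V → V → ℕ∞
  dist u v = proj₁ (∃dist u v)

  dist-isDist : ∀ u v → IsDist u v (dist u v)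
  dist-isDist u v = proj₂ (∃dist u v)

open Graph using (order; V; dist)

-- Profile complexity

subsets : ∀ n → List (Subset n)
subsets zero    = [] ∷ []
subsets (suc n) = map (inside ∷_) (subsets n) ++ map (outside ∷_) (subsets n)

subsets-complete : ∀ {n} (A : Subset n) → A ∈ᴸ subsets n
subsets-complete []            = here refl
subsets-complete (inside  ∷ A) = ∈-++⁺ˡ (∈-map⁺ (inside ∷_) (subsets-complete A))
subsets-complete (outside ∷ A) =
  ∈-++⁺ʳ (map (inside ∷_) (subsets _)) (∈-map⁺ (outside ∷_) (subsets-complete A))

module _ (G : Graph) where

  -- A function A → ℕ∞ is represented by a function on all of V G; two such
  -- functions are identified when they agree on A.

  profile : ℕ → V G → V G → ℕ∞
  profile r v a = Cap r (dist G a v)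

  AgreeOn : Subset (order G) → Rel (V G → ℕ∞) 0ℓ
  AgreeOn A p q = ∀ a → a ∈ A → p a ≡ q a

  agreeOn? : ∀ A → Decidable (AgreeOn A)
  agreeOn? A p q = all? (λ a → (a ∈? A) →-dec (p a ≟∞ q a))

  profiles : ℕ → Subset (order G) → List (V G → ℕ∞)
  profiles r A = deduplicate (agreeOn? A)
    (filter (λ p → ¬? (agreeOn? A p (λ _ → ∞)))
      (map (profile r) (allFin (order G))))

  pcOn : ℕ → Subset (order G) → ℕ
  pcOn r A = length (profiles r A)

  -- The maximum is taken to be 0 when G has fewer than k vertices.

  pc : ℕ → ℕ → ℕ
  pc r k = Extrema.max ℕ.≤-totalOrder 0
    (map (pcOn r) (filter (λ A → ∣ A ∣ ℕ.≟ k) (subsets (order G))))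

-- Trees

module _ (T : Graph) where
  open Graph T using (_~_)

  -- The vertices c 0, …, c (m + 2) are distinct and cyclically adjacent.

  record Cycle : Set where
    field
      {m}      : ℕ
      c        : Fin (3 + m) → V T
      distinct : Injective _≡_ _≡_ c
      step     : ∀ i → c (inject₁ i) ~ c (suc i)
      close    : c (fromℕ (2 + m)) ~ c zero

  record IsTree : Set where
    field
      root      : V T
      connected : ∀ s t → Star _~_ s t
      acyclic   : ¬ Cycle

  -- A connected subgraph of a tree is induced by its nodes, so a subtree is
  -- given by a nonempty node set inducing a connected subgraph.

  record IsSubtree (S : Subset (order T)) : Set where
    field
      nonempty  : Nonempty S
      connected : ∀ {s t} → s ∈ S → t ∈ S →
                  Star (λ x y → x ∈ S × y ∈ S × x ~ y) s t

-- Treelength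

record TreeRepresentation (G : Graph) : Set₁ where
  open Graph G using (_~_)
  field
    T         : Graph
    isTree    : IsTree T
    nodes     : V G → Subset (order T)
    isSubtree : ∀ v → IsSubtree T (nodes v)
    share     : ∀ {u v} → u ~ v → ∃[ t ] t ∈ nodes u × t ∈ nodes v

  bag : V T → List (V G)
  bag t = filter (λ v → t ∈? nodes v) (allFin (order G))

  repLength : ℕ∞
  repLength = Extrema.max ≤∞-totalOrder [ 0 ]
    (concatMap (λ t → cartesianProductWith (dist G) (bag t) (bag t))
               (allFin (order T)))

open TreeRepresentation using (repLength)

HasTreelength : Graph → ℕ → Set₁
HasTreelength G ℓ =
    (∃[ R ] repLength {G} R ≡ [ ℓ ])
  × (∀ (R : TreeRepresentation G) → [ ℓ ] ≤∞ repLength R)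

-- Lower bounds in two parameters tending to infinity; C is the reciprocal of
-- the usual positive constant, rounded up.

Ω : (ℕ → ℕ → ℕ) → Unary.Pred (ℕ → ℕ → ℕ) 0ℓ
Ω g f = ∃[ C ] ∃[ N ] ∀ r k → N ≤ r → N ≤ k → g r k ≤ C * f r k

module Submission where

open import Defs
open import Data.Nat.Base using (ℕ; _*_; _^_)
open import Data.Product.Base using (Σ-syntax; _×_)
open import Relation.Unary using (_∈_)

open import Level using (0ℓ)
open import Data.Bool.Base using (true)
open import Data.Nat.Base using (zero; suc; _+_; _∸_; _≤_; _<_; z≤n; s≤s; _≤ᵇ_; ⌊_/2⌋; ⌈_/2⌉)
import Data.Nat.Properties as ℕ
open import Data.Nat.Solver using (module +-*-Solver)
open import Data.Fin.Base using (Fin; zero; suc; toℕ; inject₁; fromℕ; combine; finToFun; funToFin)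
import Data.Fin.Properties as Fin
open import Data.Fin.Relation.Unary.Top using (view; ‵fromℕ; ‵inject₁)
open import Data.Fin.Subset using (Subset; inside; outside; ∣_∣; _∉_; ⊥) renaming (_∈_ to _∈ₛ_)
open import Data.Fin.Subset.Properties using (_∈?_; ∉⊥; ∣⊥∣≡0)
open import Data.Vec.Base using (_∷_; tabulate; _[_]≔_; here; there)
open import Data.Vec.Properties
  using (lookup∘tabulate; []≔-updates; []≔-minimal; lookup∘update′; []=⇒lookup; lookup⇒[]=)
open import Data.List.Base using (lookup; allFin; concatMap; cartesianProductWith)
open import Data.List.Membership.Propositional using (lose; find) renaming (_∈_ to _∈ₗ_)
open import Data.List.Membership.Propositional.Properties
  using (∈-map⁺; ∈-allFin; ∈-filter⁺; ∈-filter⁻; ∈-concatMap⁺; ∈-concatMap⁻;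
         ∈-cartesianProductWith⁺; ∈-cartesianProductWith⁻)
import Data.List.Membership.Setoid.Properties as SetoidMembership
import Data.List.Relation.Unary.All as All
import Data.List.Relation.Unary.Any as Any
open import Data.List.Relation.Unary.Any.Properties using (lookup-index)
import Data.List.Extrema as Extrema
open import Data.Product.Base using (∃-syntax; _,_; proj₁; proj₂)
open import Data.Product.Function.NonDependent.Propositional using (_×-↔_)
open import Data.Product.Properties using (≡-dec)
open import Data.Sum.Base using (_⊎_; inj₁; inj₂)
open import Data.Sum.Function.Propositional using (_⊎-↔_)
open import Function.Base using (_∘_; case_of_)
open import Function.Bundles using (_↔_; Inverse; Injection)
open import Function.Construct.Composition using (_↔-∘_)
open import Function.Construct.Identity using (↔-id)
open import Function.Definitions using (Injective)
open import Function.Properties.Inverse using (↔⇒↣)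
open import Relation.Binary.Bundles using (Setoid; TotalOrder)
open import Relation.Binary.Core using (Rel)
open import Relation.Binary.Definitions using (Decidable)
open import Relation.Binary.Construct.Closure.ReflexiveTransitive as Star using (Star; ε; _◅_; _◅◅_)
open import Relation.Binary.Construct.Closure.Symmetric as Symmetric using (SymClosure; fwd; bwd)
open import Relation.Binary.PropositionalEquality
open import Relation.Nullary
  using (¬_; Dec; yes; no; does; proof; contradiction; ¬?; _×-dec_; _⊎-dec_)
open import Relation.Nullary.Construct.Add.Supremum using ([_]; []-injective)
open import Relation.Nullary.Decidable using (map′; dec-true)
open import Relation.Nullary.Reflects using (Reflects; invert)
open Graph using (V; dist; order)

-- Blow up every vertex x of a comb with n teeth of n vertices each into a clique
-- {(x , S)}, S ranging over the bit strings of length m, and attach m + 1 probes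
-- to the clique at the root so that probe t is at distance depth x + 1 + S(t)
-- from (x , S) and one of them is at distance depth x + 1. Together with a
-- vertex (tip , full) over the far end of the spine they form A: the probes
-- reveal depth x and S, the tip then reveals the distance from x to the tip, and
-- these two distances determine x. With n = ⌊ r /2⌋ no distance exceeds r, so
-- there are n² 2ᵐ distinct profiles for |A| = m + 2.
--
-- The comb is also the tree of a representation: the bag at x consists of the
-- copies of x and of its parent, plus the probes at the root. Two labels over a
-- comb edge induce a C₄, and some bag contains two opposite vertices of it.

-- Distances

module _ (G : Graph) where
  open Graph G using (_~_; Walk; ε; _◅_; IsDist; dist-isDist)

  IsDist-unique : ∀ {u v d e} → IsDist u v d → IsDist u v e → d ≡ e
  IsDist-unique {d = [ d ]} {[ e ]} (p , d≤) (q , e≤) = cong [_] (ℕ.≤-antisym (d≤ q) (e≤ p))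
  IsDist-unique {d = [ d ]} {∞} (p , _) none = contradiction p none
  IsDist-unique {d = ∞} {[ e ]} none (q , _) = contradiction q none
  IsDist-unique {d = ∞} {∞} _ _ = refl

  dist-≤ : ∀ {u v ℓ} → Walk u v ℓ → dist G u v ≤∞ [ ℓ ]
  dist-≤ {u} {v} p with dist G u v | dist-isDist u v
  ... | [ _ ] | _ , least = [ least p ]≤
  ... | ∞     | none      = contradiction p none

  2≤dist : ∀ {u v} → u ≢ v → ¬ u ~ v → [ 2 ] ≤∞ dist G u v
  2≤dist {u} {v} u≢v u≁v with dist G u v | dist-isDist u v
  ... | [ 0 ]           | ε , _     = contradiction refl u≢v
  ... | [ 1 ]           | e ◅ ε , _ = contradiction e u≁v
  ... | [ suc (suc _) ] | _         = [ s≤s (s≤s z≤n) ]≤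
  ... | ∞               | _         = _ ≤⊤⁺

  snoc : ∀ {u v w ℓ} → Walk u v ℓ → v ~ w → Walk u w (suc ℓ)
  snoc ε       f = f ◅ ε
  snoc (e ◅ p) f = e ◅ snoc p f

  -- A local certificate for the distance from `a`: following `descent` down to zero yields a walk
  -- of length `f v`, and `lipschitz` forbids a shorter one. Distances are computed from it without
  -- unfolding the search behind `dist`.
  record IsPotential (a : V G) (f : V G → ℕ) : Set where
    field
      at-source   : f a ≡ 0
      only-source : ∀ {v} → f v ≡ 0 → v ≡ a
      lipschitz   : ∀ {u v} → u ~ v → f v ≤ suc (f u)
      descent     : ∀ {v d} → f v ≡ suc d → ∃[ u ] u ~ v × f u ≡ d

    walk-from-source : ∀ d {v} → f v ≡ d → Walk a v d
    walk-from-source zero    eq with refl ← only-source eq = ε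
    walk-from-source (suc d) eq with u , e , eq′ ← descent eq = snoc (walk-from-source d eq′) e

    growth : ∀ {u v ℓ} → Walk u v ℓ → f v ≤ ℓ + f u
    growth ε = ℕ.≤-refl
    growth {u} {v} {suc ℓ} (_◅_ {w = w} e p) = begin
      f v             ≤⟨ growth p ⟩
      ℓ + f w         ≤⟨ ℕ.+-monoʳ-≤ ℓ (lipschitz e) ⟩
      ℓ + suc (f u)   ≡⟨ ℕ.+-suc ℓ (f u) ⟩
      suc (ℓ + f u)   ∎
      where open ℕ.≤-Reasoning

    dist≡ : ∀ v → dist G a v ≡ [ f v ]
    dist≡ v = IsDist-unique (dist-isDist a v)
      ( walk-from-source (f v) refl
      , λ {ℓ} p → ℕ.≤-trans (growth p)
          (ℕ.≤-reflexive (trans (cong (ℓ +_) at-source) (ℕ.+-identityʳ ℓ))))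

-- Counting profiles

Cap-≤ : ∀ {r ℓ} → ℓ ≤ r → Cap r [ ℓ ] ≡ [ ℓ ]
Cap-≤ {r} {ℓ} ℓ≤r with ℓ ≤ᵇ r | ℕ.≤⇒≤ᵇ ℓ≤r
... | true | _ = refl

∣insert∣ : ∀ {n} (p : Subset n) x → x ∉ p → ∣ p [ x ]≔ inside ∣ ≡ suc ∣ p ∣
∣insert∣ (inside  ∷ p) zero    x∉p = contradiction here x∉p
∣insert∣ (outside ∷ p) zero    x∉p = refl
∣insert∣ (inside  ∷ p) (suc x) x∉p = cong suc (∣insert∣ p x (x∉p ∘ there))
∣insert∣ (outside ∷ p) (suc x) x∉p = ∣insert∣ p x (x∉p ∘ there)

∈-insert⁻ : ∀ {n} (p : Subset n) x {y} → y ≢ x → y ∈ₛ p [ x ]≔ inside → y ∈ₛ p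
∈-insert⁻ p x y≢x y∈ =
  lookup⇒[]= _ p (trans (sym (lookup∘update′ y≢x p inside)) ([]=⇒lookup y∈))

-- Needed because `pc` ranges over subsets of exact cardinality. The last component serves the
-- induction: it shows that `f zero` is fresh.
image : ∀ {k n} (f : Fin k → Fin n) → Injective _≡_ _≡_ f →
        Σ[ A ∈ Subset n ] ∣ A ∣ ≡ k × (∀ i → f i ∈ₛ A) × (∀ {y} → y ∈ₛ A → ∃[ i ] y ≡ f i)
image {zero} {n} f inj = ⊥ , ∣⊥∣≡0 n , (λ ()) , λ y∈ → contradiction y∈ ∉⊥
image {suc k} f inj with image (f ∘ suc) (Fin.suc-injective ∘ inj)
... | A , ∣A∣≡k , f∈A , A⊆f =
  A [ f zero ]≔ inside , trans (∣insert∣ A (f zero) fresh) (cong suc ∣A∣≡k) , mem , mem⁻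
  where
  fresh : f zero ∉ A
  fresh f0∈A with i , eq ← A⊆f f0∈A with () ← inj eq

  mem : ∀ i → f i ∈ₛ A [ f zero ]≔ inside
  mem zero    = []≔-updates A (f zero)
  mem (suc i) = []≔-minimal A (f (suc i)) (f zero) ((λ ()) ∘ inj) (f∈A i)

  mem⁻ : ∀ {y} → y ∈ₛ A [ f zero ]≔ inside → ∃[ i ] y ≡ f i
  mem⁻ {y} y∈ with y Fin.≟ f zero
  ... | yes eq = zero , eq
  ... | no neq with i , eq ← A⊆f (∈-insert⁻ A (f zero) neq y∈) = suc i , eq

module _ (G : Graph) where

  agreeOn-setoid : Subset (order G) → Setoid 0ℓ 0ℓ
  agreeOn-setoid A = record
    { Carrier = V G → ℕ∞
    ; _≈_ = AgreeOn G A
    ; isEquivalence = record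
      { refl  = λ _ _ → refl
      ; sym   = λ p≈q a a∈A → sym (p≈q a a∈A)
      ; trans = λ p≈q q≈s a a∈A → trans (p≈q a a∈A) (q≈s a a∈A)
      }
    }

  -- Each profile survives the filter by `finite`, so deduplication keeps a representative of its
  -- class. Sending `i` to the position of that representative is injective, because two profiles
  -- agreeing with one entry agree with each other.
  pcOn-≥ : ∀ {N} r A (v : Fin N → V G) →
           (∀ i → ∃[ a ] a ∈ₛ A × profile G r (v i) a ≢ ∞) →
           (∀ {i j} → AgreeOn G A (profile G r (v i)) (profile G r (v j)) → i ≡ j) →
           N ≤ pcOn G r A
  pcOn-≥ {N} r A v finite distinct =
    Fin.injective⇒≤ {f = λ i → Any.index (listed i)} λ {i} {j} eq → distinct (S.trans
      (lookup-index (listed i))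
      (S.trans (S.reflexive (cong (lookup (profiles G r A)) eq))
               (S.sym (lookup-index (listed j)))))
    where
    module S = Setoid (agreeOn-setoid A)

    listed : ∀ i → Any.Any (AgreeOn G A (profile G r (v i))) (profiles G r A)
    listed i = SetoidMembership.∈-deduplicate⁺ (agreeOn-setoid A) (agreeOn? G A)
      (λ q≈p s≈p → S.trans s≈p (S.sym q≈p))
      (Any.map S.reflexive
        (∈-filter⁺ (λ p → ¬? (agreeOn? G A p (λ _ → ∞)))
          (∈-map⁺ (profile G r) (∈-allFin (v i)))
          λ agree → let a , a∈A , neq = finite i in neq (agree a a∈A)))

  pcOn≤pc : ∀ r A → pcOn G r A ≤ pc G r ∣ A ∣
  pcOn≤pc r A = All.lookup (Extrema.xs≤max ℕ.≤-totalOrder 0 _)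
    (∈-map⁺ (pcOn G r) (∈-filter⁺ (λ B → ∣ B ∣ ℕ.≟ ∣ A ∣) (subsets-complete A) refl))

  pc-≥ : ∀ {N k} r (a : Fin k → V G) → Injective _≡_ _≡_ a → (v : Fin N → V G) →
         (∀ i → ∃[ t ] profile G r (v i) (a t) ≢ ∞) →
         (∀ {i j} → (∀ t → profile G r (v i) (a t) ≡ profile G r (v j) (a t)) → i ≡ j) →
         N ≤ pc G r k
  pc-≥ r a a-inj v finite distinct with A , refl , a∈A , _ ← image a a-inj =
    ℕ.≤-trans
      (pcOn-≥ r A v (λ i → let t , neq = finite i in a t , a∈A t , neq)
                    (λ agree → distinct (λ t → agree (a t) (a∈A t))))
      (pcOn≤pc r A)

-- Trees

module _ (T : Graph) where
  open Graph T using (_~_; ~-irrefl)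

  -- Vertices form an injective function on `Fin`, ready to become the `c` of a `Cycle`. The
  -- relation `R` is kept general so that side conditions on the steps survive loop erasure.
  record Path (R : Rel (V T) 0ℓ) (u v : V T) : Set where
    field
      {len}  : ℕ
      node   : Fin (suc len) → V T
      unique : Injective _≡_ _≡_ node
      start  : node zero ≡ u
      end    : node (fromℕ len) ≡ v
      step   : ∀ i → R (node (inject₁ i)) (node (suc i))

  suffix : ∀ {R u v} (P : Path R u v) i → Path R (Path.node P i) v
  suffix record { node = c ; unique = inj ; end = e ; step = s } zero =
    record { node = c ; unique = inj ; start = refl ; end = e ; step = s }
  suffix record { len = suc _ ; node = c ; unique = inj ; end = e ; step = s } (suc i) =
    suffix (record { node = c ∘ suc ; unique = Fin.suc-injective ∘ inj
                   ; start = refl ; end = e ; step = s ∘ suc }) i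

  extend : ∀ {R u w v} → R u w → (P : Path R w v) → (∀ i → Path.node P i ≢ u) → Path R u v
  extend {R} {u} e record { node = c ; unique = inj ; start = refl ; end = end ; step = s } fresh = record
    { node = node ; unique = unique _ _ ; start = refl ; end = end ; step = step }
    where
    node : Fin (suc _) → V T
    node zero    = u
    node (suc i) = c i

    unique : ∀ i j → node i ≡ node j → i ≡ j
    unique zero    zero    _  = refl
    unique zero    (suc j) eq = contradiction (sym eq) (fresh j)
    unique (suc i) zero    eq = contradiction eq (fresh i)
    unique (suc i) (suc j) eq = cong suc (inj eq)

    step : ∀ i → R (node (inject₁ i)) (node (suc i))
    step zero    = e
    step (suc i) = s i

  loop-erasure : ∀ {R u v} → Star R u v → Path R u v
  loop-erasure {u = u} ε = record
    { len = 0 ; node = λ _ → u ; unique = λ { {zero} {zero} _ → refl }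
    ; start = refl ; end = refl ; step = λ () }
  loop-erasure {u = u} (e ◅ es) with P ← loop-erasure es
    with Fin.any? (λ i → Path.node P i Fin.≟ u)
  ... | yes (i , refl) = suffix P i
  ... | no fresh       = extend e P (λ i eq → fresh (i , eq))

  -- In contrapositive form: every edge of an acyclic graph is a bridge.
  cycle-through : ∀ {s s′} → s ~ s′ →
                  Star (λ x y → x ~ y × ¬ (x ≡ s′ × y ≡ s)) s′ s → Cycle T
  cycle-through s~s′ walk with loop-erasure walk
  -- A path of length 0 would make the edge a loop, and one of length 1 would be the forbidden step
  -- itself; hence at least three vertices remain.
  ... | record { len = 0 ; start = refl ; end = refl } = contradiction s~s′ ~-irrefl
  ... | record { len = 1 ; start = refl ; end = refl ; step = step } =
    contradiction (refl , refl) (proj₂ (step zero))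
  ... | record { len = suc (suc m) ; node = c ; unique = inj ; start = refl ; end = refl ; step = step } =
    record { c = c ; distinct = inj ; step = proj₁ ∘ step ; close = s~s′ }

  -- The last exit is taken rather than the first so that everything after it avoids `S`; this keeps
  -- the remaining walk from returning over the exit edge.
  last-exit : ∀ {R : Rel (V T) 0ℓ} {S : Subset (order T)} {u v} → Star R u v → v ∉ S →
              (u ∉ S × Star (λ x y → R x y × y ∉ S) u v) ⊎
              (∃[ s ] ∃[ s′ ] s ∈ₛ S × s′ ∉ S × R s s′ × Star (λ x y → R x y × y ∉ S) s′ v)
  last-exit ε v∉S = inj₁ (v∉S , ε)
  last-exit {S = S} {u} (e ◅ es) v∉S with last-exit es v∉S
  ... | inj₂ exit = inj₂ exit
  ... | inj₁ (w∉S , es′) with u ∈? S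
  ...   | yes u∈S = inj₂ (u , _ , u∈S , w∉S , e , es′)
  ...   | no  u∉S = inj₁ (u∉S , (e , w∉S) ◅ es′)

  module _ {A B C D : Subset (order T)}
           (subA : IsSubtree T A) (subB : IsSubtree T B) (subC : IsSubtree T C) (subD : IsSubtree T D)
           where

    private
      Meet : Rel (Subset (order T)) 0ℓ
      Meet X Y = ∃[ t ] t ∈ₛ X × t ∈ₛ Y

    -- Otherwise leave A for C inside B by an edge s s′; returning through C, D
    -- and A avoids that edge and closes a cycle.
    four-subtrees : ¬ Cycle T → Meet A B → Meet B C → Meet C D → Meet D A →
                    Meet A C ⊎ Meet B D
    four-subtrees acyclic (p , p∈A , p∈B) (q , q∈B , q∈C) (x , x∈C , x∈D) (y , y∈D , y∈A)
      with Fin.any? (λ t → (t ∈? A) ×-dec (t ∈? C)) | Fin.any? (λ t → (t ∈? B) ×-dec (t ∈? D))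
    ... | yes meet | _ = inj₁ meet
    ... | no _     | yes meet = inj₂ meet
    ... | no A∩C   | no B∩D
      with last-exit {S = A} (IsSubtree.connected subB p∈B q∈B) (λ q∈A → A∩C (q , q∈A , q∈C))
    ... | inj₁ (p∉A , _) = contradiction p∈A p∉A
    ... | inj₂ (s , s′ , s∈A , s′∉A , (s∈B , _ , s~s′) , es) = contradiction
      (cycle-through s~s′
        -- No leg takes the step from `s′` to `s`: the first three never step onto `s`, which lies
        -- in both `A` and `B` (the rest of the walk in `B` avoids `A`, `C` misses `A`, `D` misses
        -- `B`), and the leg inside `A` never visits `s′`.
        (Star.map (λ ((_ , _ , e) , y∉A) → e , λ { (_ , refl) → y∉A s∈A }) es
         ◅◅ Star.map (λ (_ , y∈C , e) → e , λ { (_ , refl) → A∩C (_ , s∈A , y∈C) })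
              (IsSubtree.connected subC q∈C x∈C)
         ◅◅ Star.map (λ (_ , y∈D , e) → e , λ { (_ , refl) → B∩D (_ , s∈B , y∈D) })
              (IsSubtree.connected subD x∈D y∈D)
         ◅◅ Star.map (λ (x∈A , _ , e) → e , λ { (refl , _) → s′∉A x∈A })
              (IsSubtree.connected subA y∈A s∈A)))
      acyclic

  maximum : ∀ {n} (f : Fin (suc n) → ℕ) → ∃[ i ] (∀ j → f j ≤ f i)
  maximum {zero} f = zero , λ { zero → ℕ.≤-refl }
  maximum {suc n} f with i , max ← maximum (f ∘ suc) with ℕ.≤-total (f zero) (f (suc i))
  ... | inj₁ ≤i = suc i , λ { zero → ≤i ; (suc j) → max j }
  ... | inj₂ i≤ = zero , λ { zero → ℕ.≤-refl ; (suc j) → ℕ.≤-trans (max j) i≤ }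

  module _ (C : Cycle T) where
    open Cycle C

    -- At the two wraparound positions the neighbours differ because a cycle has at least three
    -- vertices.
    cycle-neighbours : ∀ i → ∃[ p ] ∃[ q ] p ≢ q × c p ~ c i × c i ~ c q
    cycle-neighbours zero = fromℕ (2 + m) , suc zero , (λ ()) , close , step zero
    cycle-neighbours (suc j) with view j
    ... | ‵fromℕ     = inject₁ j , zero , (λ ()) , step j , close
    ... | ‵inject₁ i = inject₁ j , suc (suc i) , j≢2+i , step j , step (suc i)
      where
      j≢2+i : inject₁ j ≢ suc (suc i)
      j≢2+i eq = ℕ.<⇒≢ (ℕ.m<n⇒m<1+n (ℕ.n<1+n (toℕ i)))
        (trans (sym (trans (Fin.toℕ-inject₁ j) (Fin.toℕ-inject₁ i))) (cong toℕ eq))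

  -- Both neighbours of a deepest vertex of a cycle would be its parent.
  unique-parents⇒acyclic :
    (_◁_ : Rel (V T) 0ℓ) (depth : V T → ℕ) →
    (∀ {u v} → u ~ v → u ◁ v ⊎ v ◁ u) →
    (∀ {u v} → u ◁ v → depth u < depth v) →
    (∀ {u v w} → u ◁ w → v ◁ w → u ≡ v) →
    ¬ Cycle T
  unique-parents⇒acyclic _◁_ depth orient deeper unique C
    with i , max ← maximum (depth ∘ Cycle.c C)
    with p , q , p≢q , p~i , i~q ← cycle-neighbours C i
    with orient p~i | orient i~q
  ... | inj₁ p◁i | inj₂ q◁i = p≢q (Cycle.distinct C (unique p◁i q◁i))
  ... | inj₂ i◁p | _        = ℕ.<⇒≱ (deeper i◁p) (max p)
  ... | inj₁ _   | inj₁ i◁q = ℕ.<⇒≱ (deeper i◁q) (max q)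

-- Treelength

≤∞-trans : ∀ {a b c} → a ≤∞ b → b ≤∞ c → a ≤∞ c
≤∞-trans = TotalOrder.trans ≤∞-totalOrder

module _ {G : Graph} where
  open Graph G using (_~_)

  module _ (R : TreeRepresentation G) where
    open TreeRepresentation R

    dist≤repLength : ∀ {t u v} → t ∈ₛ nodes u → t ∈ₛ nodes v → dist G u v ≤∞ repLength
    dist≤repLength {t} {u} {v} t∈u t∈v = All.lookup (Extrema.xs≤max ≤∞-totalOrder [ 0 ] _)
      (∈-concatMap⁺ _ (lose (∈-allFin t)
        (∈-cartesianProductWith⁺ (dist G)
          (∈-filter⁺ (λ w → t ∈? nodes w) (∈-allFin u) t∈u)
          (∈-filter⁺ (λ w → t ∈? nodes w) (∈-allFin v) t∈v))))

    repLength≤ : ∀ {ℓ} → (∀ {t u v} → t ∈ₛ nodes u → t ∈ₛ nodes v → dist G u v ≤∞ [ ℓ ]) →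
                 repLength ≤∞ [ ℓ ]
    repLength≤ {ℓ} bound = Extrema.max≤v⁺ ≤∞-totalOrder [ z≤n ]≤ (All.tabulate bounded)
      where
      bounded : ∀ {d} →
        d ∈ₗ concatMap (λ t → cartesianProductWith (dist G) (bag t) (bag t)) (allFin (order T)) →
        d ≤∞ [ ℓ ]
      bounded d∈ with t , _ , d∈t ← find (∈-concatMap⁻ _ {xs = allFin (order T)} d∈)
        with u , v , u∈ , v∈ , refl ← ∈-cartesianProductWith⁻ (dist G) (bag t) (bag t) d∈t =
        bound {t} (proj₂ (∈-filter⁻ (λ w → t ∈? nodes w) {xs = allFin (order G)} u∈))
                  (proj₂ (∈-filter⁻ (λ w → t ∈? nodes w) {xs = allFin (order G)} v∈))

    -- By `four-subtrees` a diagonal pair shares a bag, and its ends are distinct and nonadjacent.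
    inducedC₄⇒2≤repLength : ∀ {a b c d} → a ~ b → b ~ c → c ~ d → d ~ a →
      a ≢ c → ¬ a ~ c → b ≢ d → ¬ b ~ d → [ 2 ] ≤∞ repLength
    inducedC₄⇒2≤repLength {a} {b} {c} {d} a~b b~c c~d d~a a≢c a≁c b≢d b≁d
      with four-subtrees T (isSubtree a) (isSubtree b) (isSubtree c) (isSubtree d)
             (IsTree.acyclic isTree) (share a~b) (share b~c) (share c~d) (share d~a)
    ... | inj₁ (t , t∈a , t∈c) = ≤∞-trans (2≤dist G a≢c a≁c) (dist≤repLength t∈a t∈c)
    ... | inj₂ (t , t∈b , t∈d) = ≤∞-trans (2≤dist G b≢d b≁d) (dist≤repLength t∈b t∈d)

-- Graphs on types in bijection with Fin n

module Encoded {n : ℕ} {W : Set} (W↔ : Fin n ↔ W) {_⇒_ : Rel W 0ℓ}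
               (_⇒?_ : Decidable _⇒_) (⇒-irrefl : ∀ {w} → ¬ w ⇒ w) where

  infix 4 _—_

  -- Orienting edges by `_⇒_` lets each kind of edge be described once; in the comb the orientation
  -- is also the parent relation.
  _—_ : Rel W 0ℓ
  _—_ = SymClosure _⇒_

  decode : Fin n → W
  decode = Inverse.to W↔

  encode : W → Fin n
  encode = Inverse.from W↔

  decode-encode : ∀ w → decode (encode w) ≡ w
  decode-encode = Inverse.strictlyInverseˡ W↔

  encode-decode : ∀ v → encode (decode v) ≡ v
  encode-decode = Inverse.strictlyInverseʳ W↔

  encode-injective : ∀ {v w} → encode v ≡ encode w → v ≡ w
  encode-injective {v} {w} eq =
    trans (sym (decode-encode v)) (trans (cong decode eq) (decode-encode w))

  —-irrefl : ∀ {w} → ¬ w — w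
  —-irrefl (fwd e) = ⇒-irrefl e
  —-irrefl (bwd e) = ⇒-irrefl e

  _—?_ : Decidable _—_
  v —? w = map′ (λ { (inj₁ e) → fwd e ; (inj₂ e) → bwd e })
                (λ { (fwd e) → inj₁ e ; (bwd e) → inj₂ e }) ((v ⇒? w) ⊎-dec (w ⇒? v))

  graph : Graph
  graph = record
    { order    = n
    ; _~_      = λ u v → decode u — decode v
    ; _~?_     = λ u v → decode u —? decode v
    ; ~-sym    = Symmetric.symmetric _⇒_
    ; ~-irrefl = —-irrefl
    }

  open Graph graph using (_~_; ~-sym; ε; _◅_)

  edge : ∀ {v w} → v — w → encode v ~ encode w
  edge {v} {w} = subst₂ _—_ (sym (decode-encode v)) (sym (decode-encode w))

  edge⁻ : ∀ {v w} → encode v ~ encode w → v — w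
  edge⁻ {v} {w} = subst₂ _—_ (decode-encode v) (decode-encode w)

  edgeˡ : ∀ {v u} → v — decode u → encode v ~ u
  edgeˡ {v} = subst (_— _) (sym (decode-encode v))

  potential : (a : W) (f : W → ℕ) → f a ≡ 0 → (∀ {w} → f w ≡ 0 → w ≡ a) →
              (∀ {v w} → v ⇒ w → f w ≤ suc (f v) × f v ≤ suc (f w)) →
              (∀ w {d} → f w ≡ suc d → ∃[ v ] v — w × f v ≡ d) →
              ∀ w → dist graph (encode a) (encode w) ≡ [ f w ]
  potential a f fa≡0 f≡0⇒ lipschitz descent w =
    trans (IsPotential.dist≡ isPotential (encode w)) (cong ([_] ∘ f) (decode-encode w))
    where
    isPotential : IsPotential graph (encode a) (f ∘ decode)
    isPotential = record
      { at-source   = trans (cong f (decode-encode a)) fa≡0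
      ; only-source = λ {v} eq → trans (sym (encode-decode v)) (cong encode (f≡0⇒ eq))
      ; lipschitz   = λ { (fwd e) → proj₁ (lipschitz e) ; (bwd e) → proj₂ (lipschitz e) }
      ; descent     = λ {v} eq → let u , e , fu≡d = descent (decode v) eq in
                        encode u , edgeˡ e , trans (cong f (decode-encode u)) fu≡d
      }

  -- Including equality lets a single midpoint bound distances 0, 1 and 2 alike.
  Near : Rel W 0ℓ
  Near v w = v ≡ w ⊎ v — w

  dist≤2 : ∀ {u v w} → Near w (decode u) → Near w (decode v) → dist graph u v ≤∞ [ 2 ]
  dist≤2 {u} {v} {w} nu nv = join (near nu) (near nv)
    where
    near : ∀ {v} → Near w (decode v) → encode w ≡ v ⊎ encode w ~ v
    near {v} (inj₁ refl) = inj₁ (encode-decode v)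
    near     (inj₂ e)    = inj₂ (edgeˡ e)

    join : ∀ {c} → c ≡ u ⊎ c ~ u → c ≡ v ⊎ c ~ v → dist graph u v ≤∞ [ 2 ]
    join (inj₁ refl) (inj₁ refl) = ≤∞-trans (dist-≤ graph ε) [ z≤n ]≤
    join (inj₁ refl) (inj₂ f)    = ≤∞-trans (dist-≤ graph (f ◅ ε)) [ s≤s z≤n ]≤
    join (inj₂ e)    (inj₁ refl) = ≤∞-trans (dist-≤ graph (~-sym e ◅ ε)) [ s≤s z≤n ]≤
    join (inj₂ e)    (inj₂ f)    = dist-≤ graph (~-sym e ◅ f ◅ ε)

module _ {n} {P : Fin n → Set} (P? : ∀ i → Dec (P i)) where

  comprehension : Subset n
  comprehension = tabulate (λ i → does (P? i))

  ∈-comprehension⁺ : ∀ {i} → P i → i ∈ₛ comprehension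
  ∈-comprehension⁺ {i} p =
    lookup⇒[]= i _ (trans (lookup∘tabulate _ i) (dec-true (P? i) p))

  ∈-comprehension⁻ : ∀ {i} → i ∈ₛ comprehension → P i
  ∈-comprehension⁻ {i} i∈ = invert (subst (Reflects (P i))
    (trans (sym (lookup∘tabulate _ i)) ([]=⇒lookup i∈)) (proof (P? i)))

-- The discrete metric, which is the distance inside a clique.
δ : ∀ {n} → Fin n → Fin n → ℕ
δ i j with i Fin.≟ j
... | yes _ = 0
... | no  _ = 1

δ-cases : ∀ {n} (i j : Fin n) → (i ≡ j × δ i j ≡ 0) ⊎ (i ≢ j × δ i j ≡ 1)
δ-cases i j with i Fin.≟ j
... | yes eq = inj₁ (eq , refl)
... | no neq = inj₂ (neq , refl)

δ-refl : ∀ {n} (i : Fin n) → δ i i ≡ 0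
δ-refl i with δ-cases i i
... | inj₁ (_ , eq)  = eq
... | inj₂ (neq , _) = contradiction refl neq

δ≤1 : ∀ {n} (i j : Fin n) → δ i j ≤ 1
δ≤1 i j with i Fin.≟ j
... | yes _ = z≤n
... | no  _ = ℕ.≤-refl

δ≡0⇒≡ : ∀ {n} {i j : Fin n} → δ i j ≡ 0 → i ≡ j
δ≡0⇒≡ {i = i} {j} eq with i Fin.≟ j
... | yes i≡j = i≡j

-- The comb as a rooted tree

module Comb (n′ : ℕ) where

  -- `L` is the largest coordinate. Having `n` at least 2 provides the child of the root over which
  -- the C₄ lies.
  L n : ℕ
  L = suc n′
  n = suc L

  -- A cell is (spine position , level in the tooth); spine cells have level zero.
  Cell : Set
  Cell = Fin n × Fin n

  infix 4 _◁_ _◁?_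

  _◁_ : Rel Cell 0ℓ
  (i , j) ◁ (i′ , j′) = (i ≡ i′ × toℕ j′ ≡ suc (toℕ j))
                      ⊎ (j ≡ zero × j′ ≡ zero × toℕ i′ ≡ suc (toℕ i))

  _◁?_ : Decidable _◁_
  (i , j) ◁? (i′ , j′) = ((i Fin.≟ i′) ×-dec (toℕ j′ ℕ.≟ suc (toℕ j)))
    ⊎-dec ((j Fin.≟ zero) ×-dec ((j′ Fin.≟ zero) ×-dec (toℕ i′ ℕ.≟ suc (toℕ i))))

  root tip : Cell
  root = zero , zero
  tip  = fromℕ L , zero

  -- The distances in the comb to `root` and to `tip`: down the tooth, then along the spine to one
  -- end or the other.
  depth height : Cell → ℕ
  depth  (i , j) = toℕ i + toℕ j
  height (i , j) = (L ∸ toℕ i) + toℕ j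

  ◁-depth : ∀ {x y} → x ◁ y → depth y ≡ suc (depth x)
  ◁-depth {i , j} (inj₁ (refl , eq)) = trans (cong (toℕ i +_) eq) (ℕ.+-suc (toℕ i) (toℕ j))
  ◁-depth {i , _} (inj₂ (refl , refl , eq)) = cong (_+ 0) eq

  ◁-unique : ∀ {x y z} → x ◁ z → y ◁ z → x ≡ y
  ◁-unique (inj₁ (refl , eq)) (inj₁ (refl , eq′)) =
    cong (_ ,_) (Fin.toℕ-injective (ℕ.suc-injective (trans (sym eq) eq′)))
  ◁-unique (inj₂ (refl , _ , eq)) (inj₂ (refl , _ , eq′)) =
    cong (_, zero) (Fin.toℕ-injective (ℕ.suc-injective (trans (sym eq) eq′)))
  ◁-unique (inj₁ (_ , ())) (inj₂ (_ , refl , _))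
  ◁-unique (inj₂ (_ , refl , _)) (inj₁ (_ , ()))

  depth≡0⇒root : ∀ {x} → depth x ≡ 0 → x ≡ root
  depth≡0⇒root {zero , zero} _ = refl

  parent : ∀ x {d} → depth x ≡ suc d → ∃[ y ] y ◁ x
  parent (i     , suc j) _ = (i , inject₁ j) , inj₁ (refl , cong suc (sym (Fin.toℕ-inject₁ j)))
  parent (suc i , zero)  _ =
    (inject₁ i , zero) , inj₂ (refl , refl , cong suc (sym (Fin.toℕ-inject₁ i)))

  -- Edges of a tooth lead away from the tip, edges of the spine towards it.
  ◁-height : ∀ {x y} → x ◁ y → height y ≡ suc (height x) ⊎ height x ≡ suc (height y)
  ◁-height {i , j} (inj₁ (refl , eq)) =
    inj₁ (trans (cong ((L ∸ toℕ i) +_) eq) (ℕ.+-suc (L ∸ toℕ i) (toℕ j)))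
  ◁-height {i , _} {i′ , _} (inj₂ (refl , refl , eq)) = inj₂ (cong (_+ 0)
    (trans (cong (suc L ∸_) (sym eq)) (ℕ.+-∸-assoc 1 (ℕ.≤-pred (Fin.toℕ<n i′)))))

  height≡0⇒tip : ∀ {x} → height x ≡ 0 → x ≡ tip
  height≡0⇒tip {i , zero} eq = cong (_, zero) (Fin.toℕ-injective (trans
    (ℕ.≤-antisym (ℕ.≤-pred (Fin.toℕ<n i)) (ℕ.m∸n≡0⇒m≤n (ℕ.m+n≡0⇒m≡0 (L ∸ toℕ i) eq)))
    (sym (Fin.toℕ-fromℕ L))))
  height≡0⇒tip {i , suc j} eq with () ← ℕ.m+n≡0⇒n≡0 (L ∸ toℕ i) eq

  height-tip : height tip ≡ 0
  height-tip = trans (ℕ.+-identityʳ (L ∸ toℕ (fromℕ L)))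
    (trans (cong (L ∸_) (Fin.toℕ-fromℕ L)) (ℕ.n∸n≡0 L))

  lower : ∀ x {h} → height x ≡ suc h → ∃[ y ] (y ◁ x ⊎ x ◁ y) × height y ≡ h
  lower (i , suc j) eq = (i , inject₁ j) , inj₁ (inj₁ (refl , cong suc (sym (Fin.toℕ-inject₁ j)))) ,
    ℕ.suc-injective (trans (sym (ℕ.+-suc (L ∸ toℕ i) _))
      (trans (cong (λ k → (L ∸ toℕ i) + suc k) (Fin.toℕ-inject₁ j)) eq))
  -- On the spine the next cell towards the tip is a child; only the tip itself has none, and its
  -- height is 0.
  lower (i , zero) eq with view i
  ... | ‵fromℕ with () ← trans (sym eq) height-tip
  ... | ‵inject₁ k = (suc k , zero) , inj₂ k◁ , ℕ.suc-injective (trans (sym k-height) eq)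
    where
    k◁ : (inject₁ k , zero) ◁ (suc k , zero)
    k◁ = inj₂ (refl , refl , cong suc (sym (Fin.toℕ-inject₁ k)))

    k-height : height (inject₁ k , zero) ≡ suc (height (suc k , zero))
    k-height rewrite Fin.toℕ-inject₁ k =
      cong (_+ 0) (ℕ.+-∸-assoc 1 {L} {suc (toℕ k)} (Fin.toℕ<n k))

  -- The sum of the two distances is `L + 2 * toℕ j`, which reveals the level; the depth then
  -- reveals the spine position.
  depth-height-injective : ∀ {x y} → depth x ≡ depth y → height x ≡ height y → x ≡ y
  depth-height-injective {i , j} {i′ , j′} deq heq = cong₂ _,_
    (Fin.toℕ-injective (ℕ.+-cancelʳ-≡ (toℕ j) (toℕ i) (toℕ i′) (trans deq (cong (toℕ i′ +_) (sym j≡j′)))))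
    (Fin.toℕ-injective j≡j′)
    where
    height+depth : ∀ (i j : Fin n) → height (i , j) + depth (i , j) ≡ L + 2 * toℕ j
    height+depth i j = begin
      (L ∸ a + b) + (a + b)   ≡⟨ solve 3 (λ l a b → (l :+ b) :+ (a :+ b) := (l :+ a) :+ con 2 :* b) refl (L ∸ a) a b ⟩
      (L ∸ a + a) + 2 * b     ≡⟨ cong (_+ 2 * b) (ℕ.m∸n+n≡m (ℕ.≤-pred (Fin.toℕ<n i))) ⟩
      L + 2 * b               ∎
      where
      open ≡-Reasoning
      open +-*-Solver
      a = toℕ i
      b = toℕ j

    j≡j′ : toℕ j ≡ toℕ j′
    j≡j′ = ℕ.*-cancelˡ-≡ (toℕ j) (toℕ j′) 2 (ℕ.+-cancelˡ-≡ L _ _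
      (trans (sym (height+depth i j)) (trans (cong₂ _+_ heq deq) (height+depth i′ j′))))

  depth≤ : ∀ x → depth x ≤ L + L
  depth≤ (i , j) = ℕ.+-mono-≤ (ℕ.≤-pred (Fin.toℕ<n i)) (ℕ.≤-pred (Fin.toℕ<n j))

  height≤ : ∀ x → height x ≤ L + L
  height≤ (i , j) = ℕ.+-mono-≤ (ℕ.m∸n≤m L (toℕ i)) (ℕ.≤-pred (Fin.toℕ<n j))

  opaque
    Cell↔ : Fin (n * n) ↔ Cell
    Cell↔ = Fin.*↔×

  ◁-irrefl : ∀ {x} → ¬ x ◁ x
  ◁-irrefl {x} x◁x = ℕ.1+n≢n (sym (◁-depth {x} {x} x◁x))

  open Encoded Cell↔ _◁?_ (λ {x} → ◁-irrefl {x}) public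
    renaming (graph to comb; decode to cell; encode to node; decode-encode to cell-node;
              encode-decode to node-cell; edge to comb-edge)
    using ()

  private
    descend : ∀ d x → depth x ≡ d → Star (Graph._~_ comb) (node root) (node x)
    descend zero    x eq with refl ← depth≡0⇒root {x} eq = ε
    descend (suc d) x eq with y , y◁x ← parent x eq =
      descend d y (ℕ.suc-injective (trans (sym (◁-depth {y} {x} y◁x)) eq)) ◅◅ (comb-edge (fwd y◁x) ◅ ε)

    from-root : ∀ s → Star (Graph._~_ comb) (node root) s
    from-root s = subst (Star _ _) (node-cell s) (descend _ (cell s) refl)

  comb-isTree : IsTree comb
  comb-isTree = record
    { root      = node root
    ; connected = λ s t → Star.reverse (λ {u} {v} → Graph.~-sym comb {u} {v}) (from-root s) ◅◅ from-root t
    ; acyclic   = unique-parents⇒acyclic comb (λ u v → cell u ◁ cell v) (depth ∘ cell)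
        (λ { (fwd e) → inj₁ e ; (bwd e) → inj₂ e })
        (λ {u} {v} e → ℕ.≤-reflexive (sym (◁-depth {cell u} {cell v} e)))
        (λ {u} {v} {w} e f → trans (sym (node-cell u))
          (trans (cong node (◁-unique {cell u} {cell v} {cell w} e f)) (node-cell v)))
    }

funToFin-cong : ∀ {m n} {f g : Fin m → Fin n} → (∀ i → f i ≡ g i) → funToFin f ≡ funToFin g
funToFin-cong {zero}  eq = refl
funToFin-cong {suc m} eq = cong₂ combine (eq zero) (funToFin-cong (eq ∘ suc))

-- The blown-up comb

module Blowup (n′ m′ : ℕ) where

  open Comb n′

  -- At least one bit, so that `full` and `other` differ.
  m : ℕ
  m = suc m′

  Label Probe : Set
  Label = Fin (2 ^ m)
  Probe = Fin (suc m)

  bit : Label → Fin m → Fin 2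
  bit = finToFun {2} {m}

  -- Probe t is adjacent to the copies (root , S) with miss S t ≡ 0.
  miss : Label → Probe → ℕ
  miss S zero    = 0
  miss S (suc t) = toℕ (bit S t)

  miss≤1 : ∀ S t → miss S t ≤ 1
  miss≤1 S zero    = z≤n
  miss≤1 S (suc t) = ℕ.≤-pred (Fin.toℕ<n (bit S t))

  miss-injective : ∀ {S S′} → (∀ t → miss S t ≡ miss S′ t) → S ≡ S′
  miss-injective {S} {S′} eq = begin
    S                                    ≡⟨ Fin.funToFin-finToFin {m} {2} S ⟨
    funToFin {m} {2} (bit S)             ≡⟨ funToFin-cong (λ t → Fin.toℕ-injective (eq (suc t))) ⟩
    funToFin {m} {2} (bit S′)            ≡⟨ Fin.funToFin-finToFin {m} {2} S′ ⟩
    S′                                   ∎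
    where open ≡-Reasoning

  -- Bit 0 stands for adjacency, so `at root full` is a common neighbour of all probes and serves as
  -- a hub below.
  full other : Label
  full  = funToFin {m} {2} (λ _ → zero)
  other = funToFin {m} {2} (λ _ → suc zero)

  miss-full : ∀ t → miss full t ≡ 0
  miss-full zero    = refl
  miss-full (suc t) = cong toℕ (Fin.finToFun-funToFin {m} {2} (λ _ → zero) t)

  full≢other : full ≢ other
  full≢other eq with () ← trans (sym (Fin.finToFun-funToFin {m} {2} (λ _ → zero) zero))
    (trans (cong (λ S → bit S zero) eq) (Fin.finToFun-funToFin {m} {2} (λ _ → suc zero) zero))

  Copy Vertex : Set
  Copy   = Cell × Label
  Vertex = Probe ⊎ Copy

  pattern probe t = inj₁ t
  pattern at x S  = inj₂ (x , S)

  infix 4 _⇒_ _⇒?_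

  -- Between copies an edge changes the cell or the label, never both; this leaves the C₄ over a
  -- comb edge without diagonals.
  data _⇒_ : Rel Vertex 0ℓ where
    attach : ∀ {t S} → miss S t ≡ 0 → probe t ⇒ at root S
    swap   : ∀ {x S S′} → S ≢ S′ → at x S ⇒ at x S′
    climb  : ∀ {x y S} → x ◁ y → at x S ⇒ at y S

  _≟ᶜ_ : Decidable {A = Cell} _≡_
  _≟ᶜ_ = ≡-dec Fin._≟_ Fin._≟_

  _⇒?_ : Decidable _⇒_
  _       ⇒? probe _  = no λ ()
  probe t ⇒? at x S   = map′ (λ { (refl , eq) → attach eq }) (λ { (attach eq) → refl , eq })
                             ((x ≟ᶜ root) ×-dec (miss S t ℕ.≟ 0))
  at x S  ⇒? at y S′  = map′
    (λ { (inj₁ (refl , neq)) → swap neq ; (inj₂ (x◁y , refl)) → climb x◁y })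
    (λ { (swap neq) → inj₁ (refl , neq) ; (climb x◁y) → inj₂ (x◁y , refl) })
    (((x ≟ᶜ y) ×-dec ¬? (S Fin.≟ S′)) ⊎-dec ((x ◁? y) ×-dec (S Fin.≟ S′)))

  ⇒-irrefl : ∀ {w} → ¬ w ⇒ w
  ⇒-irrefl (swap neq)  = neq refl
  ⇒-irrefl (climb {x} x◁x) = ◁-irrefl {x} x◁x

  opaque
    Copy↔ : Fin ((n * n) * 2 ^ m) ↔ Copy
    Copy↔ = (Cell↔ ×-↔ ↔-id Label) ↔-∘ Fin.*↔×

    Vertex↔ : Fin (suc m + (n * n) * 2 ^ m) ↔ Vertex
    Vertex↔ = (↔-id Probe ⊎-↔ Copy↔) ↔-∘ Fin.+↔⊎

  open Encoded Vertex↔ _⇒?_ ⇒-irrefl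

  blowup : Graph
  blowup = graph

  -- Distances from the probes and from the tip

  -- Two probes meet through `at root full`. Towards a copy, one step enters the root clique,
  -- `depth x` steps climb, and one swap is added exactly when the probe misses `S`.
  probeDist : Probe → Vertex → ℕ
  probeDist t (probe t′) = 2 * δ t t′
  probeDist t (at x S)   = suc (depth x + miss S t)

  dist-probe : ∀ t w → dist blowup (encode (probe t)) (encode w) ≡ [ probeDist t w ]
  dist-probe t = potential (probe t) (probeDist t) (cong (2 *_) (δ-refl t)) source lipschitz descent
    where
    source : ∀ {w} → probeDist t w ≡ 0 → w ≡ probe t
    source {probe t′} eq = cong inj₁ (sym (δ≡0⇒≡ (ℕ.m+n≡0⇒m≡0 (δ t t′) eq)))

    lipschitz : ∀ {v w} → v ⇒ w → probeDist t w ≤ suc (probeDist t v) × probeDist t v ≤ suc (probeDist t w)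
    lipschitz (attach {t′} {S} eq) with δ-cases t t′
    ... | inj₁ (refl , d) rewrite d | eq = ℕ.≤-refl , z≤n
    ... | inj₂ (_    , d) rewrite d =
      s≤s (ℕ.≤-trans (miss≤1 S t) (s≤s z≤n)) , s≤s (s≤s z≤n)
    lipschitz (swap {x} {S} {S′} _) = close S S′ , close S′ S
      where
      close : ∀ S S′ → suc (depth x + miss S′ t) ≤ suc (suc (depth x + miss S t))
      close S S′ = s≤s (begin
        depth x + miss S′ t        ≤⟨ ℕ.+-monoʳ-≤ (depth x) (miss≤1 S′ t) ⟩
        depth x + 1                ≡⟨ ℕ.+-comm (depth x) 1 ⟩
        suc (depth x)              ≤⟨ s≤s (ℕ.m≤m+n (depth x) (miss S t)) ⟩
        suc (depth x + miss S t)   ∎)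
        where open ℕ.≤-Reasoning
    lipschitz (climb {x} {y} x◁y) rewrite ◁-depth {x} {y} x◁y = ℕ.≤-refl , ℕ.m≤n⇒m≤1+n (ℕ.n≤1+n _)

    descent : ∀ w {d} → probeDist t w ≡ suc d → ∃[ v ] v — w × probeDist t v ≡ d
    descent (probe t′) eq with δ-cases t t′
    ... | inj₁ (_ , d) rewrite d with () ← eq
    ... | inj₂ (_ , d) rewrite d =
      at root full , bwd (attach (miss-full t′)) ,
      trans (cong suc (miss-full t)) (ℕ.suc-injective eq)
    descent (at x S) eq with depth x in depth-eq
    ... | suc e with y , y◁x ← parent x depth-eq =
      at y S , fwd (climb y◁x) ,
      trans (cong (λ k → suc (k + miss S t))
              (ℕ.suc-injective (trans (sym (◁-depth {y} {x} y◁x)) depth-eq)))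
            (ℕ.suc-injective eq)
    ... | zero with refl ← depth≡0⇒root {x} depth-eq with miss S t in miss-eq
    ...   | zero = probe t , fwd (attach miss-eq) ,
      trans (cong (2 *_) (δ-refl t)) (ℕ.suc-injective eq)
    -- The probe misses `S` at the root, so a shortest walk arrives by a swap from `full`, which no
    -- probe misses; `miss≤1` forces `k` to be 0.
    ...   | suc k with z≤n ← ℕ.≤-pred (subst (_≤ 1) miss-eq (miss≤1 S t)) =
      at root full ,
      fwd (swap λ { refl → ℕ.1+n≢0 (trans (sym miss-eq) (miss-full t)) }) ,
      trans (cong suc (miss-full t)) (ℕ.suc-injective eq)

  -- The comb distance plus one swap for a label other than `full`. Probes are reached from
  -- `at root full`, hence the same value for all of them.
  tipDist : Vertex → ℕ
  tipDist (probe _) = suc (height root)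
  tipDist (at x S)  = height x + δ S full

  dist-tip : ∀ w → dist blowup (encode (at tip full)) (encode w) ≡ [ tipDist w ]
  dist-tip = potential (at tip full) tipDist (cong₂ _+_ height-tip (δ-refl full)) source lipschitz descent
    where
    source : ∀ {w} → tipDist w ≡ 0 → w ≡ at tip full
    source {at x S} eq = cong₂ at
      (height≡0⇒tip {x} (ℕ.m+n≡0⇒m≡0 (height x) eq))
      (δ≡0⇒≡ (ℕ.m+n≡0⇒n≡0 (height x) eq))

    near : ∀ h S S′ → h + δ S full ≤ suc (h + δ S′ full)
    near h S S′ = begin
      h + δ S full          ≤⟨ ℕ.+-monoʳ-≤ h (δ≤1 S full) ⟩
      h + 1                 ≡⟨ ℕ.+-comm h 1 ⟩
      suc h                 ≤⟨ s≤s (ℕ.m≤m+n h (δ S′ full)) ⟩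
      suc (h + δ S′ full)   ∎
      where open ℕ.≤-Reasoning

    lipschitz : ∀ {v w} → v ⇒ w → tipDist w ≤ suc (tipDist v) × tipDist v ≤ suc (tipDist w)
    lipschitz (attach {S = S} _) =
      ℕ.≤-trans (near (height root) S full)
        (s≤s (ℕ.≤-trans (ℕ.≤-reflexive (trans (cong (height root +_) (δ-refl full)) (ℕ.+-identityʳ _)))
                        (ℕ.n≤1+n _))) ,
      s≤s (ℕ.m≤m+n (height root) (δ S full))
    lipschitz (swap {x} {S} {S′} _) = near (height x) S′ S , near (height x) S S′
    lipschitz (climb {x} {y} x◁y) with ◁-height {x} {y} x◁y
    ... | inj₁ eq rewrite eq = ℕ.≤-refl , ℕ.m≤n⇒m≤1+n (ℕ.n≤1+n _)
    ... | inj₂ eq rewrite eq = ℕ.m≤n⇒m≤1+n (ℕ.n≤1+n _) , ℕ.≤-refl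

    descent : ∀ w {d} → tipDist w ≡ suc d → ∃[ v ] v — w × tipDist v ≡ d
    descent (probe t) eq = at root full , bwd (attach (miss-full t)) ,
      trans (cong (height root +_) (δ-refl full))
        (trans (ℕ.+-identityʳ (height root)) (ℕ.suc-injective eq))
    descent (at x S) {d} eq with δ-cases S full
    -- A wrong label is corrected first; with label `full`, a comb step towards the tip follows,
    -- which may go to the parent or to a child.
    ... | inj₂ (neq , δ≡1) = at x full , bwd (swap neq) ,
      ℕ.suc-injective (begin
        suc (height x + δ full full)   ≡⟨ cong (λ k → suc (height x + k)) (δ-refl full) ⟩
        suc (height x + 0)             ≡⟨ ℕ.+-suc (height x) 0 ⟨
        height x + 1                   ≡⟨ cong (height x +_) δ≡1 ⟨
        height x + δ S full            ≡⟨ eq ⟩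
        suc d                          ∎)
      where open ≡-Reasoning
    ... | inj₁ (refl , δ≡0)
      with y , orient , height-y ← lower x (trans (sym (trans (cong (height x +_) δ≡0) (ℕ.+-identityʳ _))) eq) =
      at y S , up orient , trans (cong₂ _+_ height-y δ≡0) (ℕ.+-identityʳ d)
      where
      up : ∀ {y} → y ◁ x ⊎ x ◁ y → at y S — at x S
      up (inj₁ y◁x) = fwd (climb y◁x)
      up (inj₂ x◁y) = bwd (climb x◁y)

  -- Treelength of the blown-up comb

  -- Seen from a copy of `x`, these bags form the star of `x` and its children, so its subtree is
  -- connected through the `center`; a probe occupies the root alone.
  InBag : Cell → Vertex → Set
  InBag c (probe _) = c ≡ root
  InBag c (at x _)  = c ≡ x ⊎ x ◁ c

  inBag? : ∀ c w → Dec (InBag c w)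
  inBag? c (probe _) = c ≟ᶜ root
  inBag? c (at x _)  = (c ≟ᶜ x) ⊎-dec (x ◁? c)

  center : Vertex → Cell
  center (probe _) = root
  center (at x _)  = x

  center-inBag : ∀ w → InBag (center w) w
  center-inBag (probe _) = refl
  center-inBag (at _ _)  = inj₁ refl

  around-center : ∀ {c} w → InBag c w → c ≡ center w ⊎ center w ◁ c
  around-center (probe _) eq = inj₁ eq
  around-center (at _ _)  p  = p

  share-bag : ∀ {v w} → v ⇒ w → ∃[ c ] InBag c v × InBag c w
  share-bag (attach _)        = root , refl , inj₁ refl
  share-bag (swap {x} _)      = x , inj₁ refl , inj₁ refl
  share-bag (climb {y = y} e) = y , inj₂ e , inj₁ refl

  clique : ∀ {x} S S′ → Near (at x S) (at x S′)
  clique S S′ with S Fin.≟ S′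
  ... | yes refl = inj₁ refl
  ... | no neq   = inj₂ (fwd (swap neq))

  ¬◁root : ∀ {x} → ¬ x ◁ root
  ¬◁root {x} x◁root with () ← ◁-depth {x} {root} x◁root

  -- Between copies the midpoint has the second cell and the first label, so one side is a comb edge
  -- or equality and the other a clique. A probe forces `c` to be the root, which has no parent, and
  -- `at root full` works.
  bag-midpoint : ∀ {c} v w → InBag c v → InBag c w → ∃[ u ] Near u v × Near u w
  bag-midpoint (probe t) (probe t′) _ _ =
    at root full , inj₂ (bwd (attach (miss-full t))) , inj₂ (bwd (attach (miss-full t′)))
  bag-midpoint (probe t) (at x S) refl (inj₁ refl) =
    at root full , inj₂ (bwd (attach (miss-full t))) , clique full S
  bag-midpoint (probe t) (at x S) refl (inj₂ x◁root) = contradiction x◁root (¬◁root {x})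
  bag-midpoint (at x S) (probe t) (inj₁ refl) refl =
    at root full , clique full S , inj₂ (bwd (attach (miss-full t)))
  bag-midpoint (at x S) (probe t) (inj₂ x◁root) refl = contradiction x◁root (¬◁root {x})
  bag-midpoint (at x S) (at y S′) (inj₁ refl) (inj₁ refl) = at x S , inj₁ refl , clique S S′
  bag-midpoint (at x S) (at y S′) (inj₁ refl) (inj₂ y◁x) =
    at y S , inj₂ (fwd (climb y◁x)) , clique S S′
  bag-midpoint (at x S) (at y S′) (inj₂ x◁y) (inj₁ refl) =
    at y S , inj₂ (bwd (climb x◁y)) , clique S S′
  bag-midpoint {c} (at x S) (at y S′) (inj₂ x◁c) (inj₂ y◁c)
    with refl ← ◁-unique {x} {y} {c} x◁c y◁c = at x S , inj₁ refl , clique S S′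

  representation : TreeRepresentation blowup
  representation = record
    { T         = comb
    ; isTree    = comb-isTree
    ; nodes     = λ v → nodesOf (decode v)
    ; isSubtree = λ v → isSubtree (decode v)
    ; share     = λ { (fwd e) → let c , p , q = share-bag e in node c , ∈-nodes p , ∈-nodes q
                    ; (bwd e) → let c , p , q = share-bag e in node c , ∈-nodes q , ∈-nodes p }
    }
    where
    nodesOf : Vertex → Subset (n * n)
    nodesOf w = comprehension (λ s → inBag? (cell s) w)

    ∈-nodes : ∀ {c w} → InBag c w → node c ∈ₛ nodesOf w
    ∈-nodes {c} {w} p = ∈-comprehension⁺ (λ s → inBag? (cell s) w)
      (subst (λ c → InBag c w) (sym (cell-node c)) p)

    isSubtree : ∀ w → IsSubtree comb (nodesOf w)
    isSubtree w = record
      { nonempty  = node (center w) , center∈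
      ; connected = λ s∈ t∈ → Star.reverse back (spoke s∈) ◅◅ spoke t∈
      }
      where
      open Graph comb using (_~_; ~-sym)

      center∈ : node (center w) ∈ₛ nodesOf w
      center∈ = ∈-nodes (center-inBag w)

      Inside : Rel (V comb) 0ℓ
      Inside s t = s ∈ₛ nodesOf w × t ∈ₛ nodesOf w × s ~ t

      back : ∀ {s t} → Inside s t → Inside t s
      back {s} {t} (s∈ , t∈ , e) = t∈ , s∈ , ~-sym {s} {t} e

      spoke : ∀ {s} → s ∈ₛ nodesOf w → Star Inside (node (center w)) s
      spoke {s} s∈ with around-center w (∈-comprehension⁻ (λ s → inBag? (cell s) w) s∈)
      ... | inj₁ eq = subst (Star Inside _) (trans (cong node (sym eq)) (node-cell s)) ε
      ... | inj₂ e  = (center∈ , s∈ ,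
        subst (λ c → SymClosure _◁_ c (cell s)) (sym (cell-node (center w))) (fwd e)) ◅ ε

  blowup-treelength : HasTreelength blowup 2
  blowup-treelength =
      -- The universal lower bound, applied to this very representation, makes its length exactly 2.
      (representation , TotalOrder.antisym ≤∞-totalOrder short (long representation))
    , long
    where
    short : TreeRepresentation.repLength representation ≤∞ [ 2 ]
    short = repLength≤ representation λ {t} {u} {v} t∈u t∈v →
      let _ , nu , nv = bag-midpoint (decode u) (decode v)
                          (∈-comprehension⁻ (λ s → inBag? (cell s) (decode u)) t∈u)
                          (∈-comprehension⁻ (λ s → inBag? (cell s) (decode v)) t∈v)
      in dist≤2 nu nv

    child : Cell
    child = zero , suc zero

    root◁child : root ◁ child
    root◁child = inj₁ (refl , refl)

    diagonal : ∀ {S S′} → S ≢ S′ → ¬ at root S — at child S′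
    diagonal neq (fwd (climb _)) = neq refl
    diagonal neq (bwd (climb _)) = neq refl

    long : ∀ R → [ 2 ] ≤∞ TreeRepresentation.repLength R
    long R = inducedC₄⇒2≤repLength R
      {encode (at root full)} {encode (at child full)} {encode (at child other)} {encode (at root other)}
      (edge (fwd (climb root◁child))) (edge (fwd (swap full≢other)))
      (edge (bwd (climb root◁child))) (edge (bwd (swap full≢other)))
      (λ eq → case encode-injective eq of λ ())
      (λ e → diagonal full≢other (edge⁻ e))
      (λ eq → case encode-injective eq of λ ())
      (λ e → diagonal (full≢other ∘ sym) (Symmetric.symmetric _⇒_ (edge⁻ e)))

  -- Profile complexity of the blown-up comb

  blowup-pc : ∀ {r} → n + n ≤ r → (n * n) * 2 ^ m ≤ pc blowup r (2 + m)
  blowup-pc {r} n+n≤r = pc-≥ blowup r a a-injective v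
    -- The tip alone shows that no profile is constantly infinite.
    (λ i → zero , λ eq → case trans (sym (profile-tip i)) eq of λ ())
    distinct
    where
    a : Fin (2 + m) → V blowup
    a zero    = encode (at tip full)
    a (suc t) = encode (probe t)

    a-injective : Injective _≡_ _≡_ a
    a-injective {zero}  {zero}   _  = refl
    a-injective {zero}  {suc _}  eq = case encode-injective eq of λ ()
    a-injective {suc _} {zero}   eq = case encode-injective eq of λ ()
    a-injective {suc _} {suc _}  eq = case encode-injective eq of λ { refl → refl }

    copy : Fin ((n * n) * 2 ^ m) → Copy
    copy = Inverse.to Copy↔

    v : Fin ((n * n) * 2 ^ m) → V blowup
    v i = encode (inj₂ (copy i))

    -- The largest probe distance is 1 + 2`L` + 1, that is `n + n`, so the cap at `r` alters
    -- nothing; tip distances are at most one less.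
    bound : ∀ {h e} → h ≤ L + L → e ≤ 1 → suc (h + e) ≤ r
    bound {h} {e} h≤ e≤1 = begin
      suc (h + e)         ≤⟨ s≤s (ℕ.+-mono-≤ h≤ e≤1) ⟩
      suc (L + L + 1)     ≡⟨ cong suc (trans (ℕ.+-assoc L L 1) (cong (L +_) (ℕ.+-comm L 1))) ⟩
      n + n               ≤⟨ n+n≤r ⟩
      r                   ∎
      where open ℕ.≤-Reasoning

    profile-tip : ∀ i → profile blowup r (v i) (a zero) ≡ [ tipDist (inj₂ (copy i)) ]
    profile-tip i = let x , S = copy i in trans (cong (Cap r) (dist-tip (at x S)))
      (Cap-≤ (ℕ.≤-trans (ℕ.n≤1+n _) (bound (height≤ x) (δ≤1 S full))))

    profile-probe : ∀ i t → profile blowup r (v i) (a (suc t)) ≡ [ probeDist t (inj₂ (copy i)) ]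
    profile-probe i t = let x , S = copy i in trans (cong (Cap r) (dist-probe t (at x S)))
      (Cap-≤ (bound (depth≤ x) (miss≤1 S t)))

    -- The label must be recovered before the height, since the tip distance contains the term
    -- `δ S full`.
    same-copy : ∀ x S y S′ → tipDist (at x S) ≡ tipDist (at y S′) →
                (∀ t → probeDist t (at x S) ≡ probeDist t (at y S′)) →
                (x , S) ≡ (y , S′)
    same-copy x S y S′ tip-eq probe-eq = cong₂ _,_
      (depth-height-injective {x} {y} depth-eq
        (ℕ.+-cancelʳ-≡ (δ S full) (height x) (height y)
          (trans tip-eq (cong (λ S → height y + δ S full) (sym S≡S′)))))
      S≡S′
      where
      depth-eq : depth x ≡ depth y
      -- Probe `zero` misses no label, so it measures the bare depth.
      depth-eq = ℕ.+-cancelʳ-≡ 0 (depth x) (depth y) (ℕ.suc-injective (probe-eq zero))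

      S≡S′ : S ≡ S′
      S≡S′ = miss-injective λ t → ℕ.+-cancelˡ-≡ (depth x) (miss S t) (miss S′ t)
        (trans (ℕ.suc-injective (probe-eq t)) (cong (_+ miss S′ t) (sym depth-eq)))

    distinct : ∀ {i j} → (∀ t → profile blowup r (v i) (a t) ≡ profile blowup r (v j) (a t)) → i ≡ j
    distinct {i} {j} agree = Injection.injective (↔⇒↣ Copy↔) (same-copy _ _ _ _
      ([]-injective (trans (sym (profile-tip i)) (trans (agree zero) (profile-tip j))))
      (λ t → []-injective (trans (sym (profile-probe i t)) (trans (agree (suc t)) (profile-probe j t)))))

-- Parameters and constants

r²2ᵏ≤ : ∀ n m r {k} p → r ≤ 3 * n → k ≡ 2 + m → (n * n) * 2 ^ m ≤ p → r ^ 2 * 2 ^ k ≤ 36 * p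
r²2ᵏ≤ n m r p r≤3n refl n²2ᵐ≤p = begin
  r ^ 2 * 2 ^ (2 + m)         ≤⟨ ℕ.*-monoˡ-≤ (2 ^ (2 + m)) (ℕ.^-monoˡ-≤ 2 r≤3n) ⟩
  -- The constant is 36 = 9 · 4: the factor 9 from `r ≤ 3 * n` squared, the factor 4 from the two
  -- elements of `A` that encode no bit, the tip and probe `zero`.
  (3 * n) ^ 2 * 2 ^ (2 + m)   ≡⟨ solve 2 (λ n q → (con 3 :* n) :^ 2 :* (con 2 :* (con 2 :* q))
                                               := con 36 :* ((n :* n) :* q)) refl n (2 ^ m) ⟩
  36 * ((n * n) * 2 ^ m)      ≤⟨ ℕ.*-monoʳ-≤ 36 n²2ᵐ≤p ⟩
  36 * p                      ∎
  where
  open ℕ.≤-Reasoning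
  open +-*-Solver

proposition29 : Σ[ H ∈ (ℕ → ℕ → Graph) ]
    (∀ r k → HasTreelength (H r k) 2) ×
    (λ r k → pc (H r k) r k) ∈ Ω (λ r k → r ^ 2 * 2 ^ k)
proposition29 =
    -- The subtractions undo the successors in `n` and in `2 + m`. For small `r` or `k` they
    -- truncate, and the graph still has treelength 2.
    (λ r k → Blowup.blowup (⌊ r /2⌋ ∸ 2) (k ∸ 3))
  , (λ r k → Blowup.blowup-treelength (⌊ r /2⌋ ∸ 2) (k ∸ 3))
  -- From 4 on, `⌊ r /2⌋` is at least 2 and `k` at least 3, so both subtractions are exact.
  , 36 , 4 , bound
  where
  -- Recursion in steps of two: the left side gains 2 and the right side 3.
  r≤3⌊r/2⌋ : ∀ {r} → 2 ≤ r → r ≤ 3 * ⌊ r /2⌋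
  r≤3⌊r/2⌋ {1} (s≤s ())
  r≤3⌊r/2⌋ {2} _ = ℕ.m≤n+m 2 1
  r≤3⌊r/2⌋ {3} _ = ℕ.≤-refl
  r≤3⌊r/2⌋ {suc (suc r@(suc (suc _)))} _ = ℕ.≤-trans
    (s≤s (s≤s (ℕ.m≤n⇒m≤1+n (r≤3⌊r/2⌋ (s≤s (s≤s z≤n))))))
    (ℕ.≤-reflexive (sym (ℕ.*-suc 3 ⌊ r /2⌋)))

  bound : ∀ r k → 4 ≤ r → 4 ≤ k → r ^ 2 * 2 ^ k ≤ 36 * pc (Blowup.blowup (⌊ r /2⌋ ∸ 2) (k ∸ 3)) r k
  bound r k 4≤r 4≤k = r²2ᵏ≤ n B.m r (pc B.blowup r k)
    (subst (λ h → r ≤ 3 * h) (sym n≡⌊r/2⌋) (r≤3⌊r/2⌋ (ℕ.≤-trans (ℕ.m≤m+n 2 2) 4≤r)))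
    (sym 2+m≡k)
    (subst (λ k → (n * n) * 2 ^ B.m ≤ pc B.blowup r k) 2+m≡k (B.blowup-pc n+n≤r))
    where
    module B = Blowup (⌊ r /2⌋ ∸ 2) (k ∸ 3)

    n : ℕ
    n = Comb.n (⌊ r /2⌋ ∸ 2)

    n≡⌊r/2⌋ : n ≡ ⌊ r /2⌋
    n≡⌊r/2⌋ = ℕ.m+[n∸m]≡n (ℕ.⌊n/2⌋-mono 4≤r)

    2+m≡k : 2 + B.m ≡ k
    2+m≡k = ℕ.m+[n∸m]≡n (ℕ.≤-trans (ℕ.n≤1+n 3) 4≤k)

    n+n≤r : n + n ≤ r
    n+n≤r = begin
      n + n               ≡⟨ cong₂ _+_ n≡⌊r/2⌋ n≡⌊r/2⌋ ⟩
      ⌊ r /2⌋ + ⌊ r /2⌋   ≤⟨ ℕ.+-monoʳ-≤ ⌊ r /2⌋ (ℕ.⌊n/2⌋≤⌈n/2⌉ r) ⟩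
      ⌊ r /2⌋ + ⌈ r /2⌉   ≡⟨ ℕ.⌊n/2⌋+⌈n/2⌉≡n r ⟩
      r                   ∎
      where open ℕ.≤-Reasoning
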